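{- Let $G=C(T_1,\ldots,T_g)$ be a unicyclic graph of order $n$ which has a perfect matching and such that $2$ is an eigenvalue of the Laplacian matrix $L(G)$. Then there exist a real number $r\neq 0$ and an eigenvector $X=(x_1,\ldots,x_n)^t$ of $L(G)$ corresponding to the eigenvalue $2$ such that $x_i\in\{ -r,r\}$ for all $i=1,\ldots,n$.
   Context: All graphs are finite, undirected, with no loops or multiple edges. The Laplacian matrix of $G$ is $L(G)=D(G)-A(G)$, where $D(G)$ is the diagonal matrix of vertex degrees and $A(G)$ is the adjacency matrix. A unicyclic graph is a connected graph whose number of edges equals its number of vertices; it consists of a cycle $C_g$ with vertices $v_1,\ldots,v_g$ and, for each $i$, a rooted tree $T_i$ of order $n_i\ge 1$ with root $v_i$, where $V(T_i)\cap V(C_g)=\{v_i\}$ and $\sum_{i=1}^g n_i=n$. Such a graph is denoted by $C(T_1,\ldots,T_g)$; every unicyclic graph has this form. -}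

module Defs where

open import Algebra.Bundles using (CommutativeRing)
import Algebra.Construct.Pointwise as Pointwise
import Algebra.Definitions.RawMonoid as RawMonoidDefinitions
open import Data.Bool.Base using (if_then_else_)
open import Data.Fin.Base using (Fin)
import Data.Fin.Base as Fin
import Data.Fin.Properties as Fin
open import Data.List.Base using (List; length; filter; allFin; cartesianProduct)
open import Data.Nat.Base using (ℕ; _⊔_; NonZero)
import Data.Nat.Base as ℕ
import Data.Nat.Properties as ℕ
open import Data.Product.Base using (Σ-syntax; ∃; _×_; _,_)
open import Data.Product using (∃!)
open import Data.Rational.Base using (ℚ; 0ℚ; 1ℚ; ½; ∣_∣; 1/_; Positive; positive)
import Data.Rational.Base as ℚ
import Data.Rational.Properties as ℚ
open import Data.Rational.Solver using (module +-*-Solver)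
open import Data.Vec.Functional using (Vector)
open import Level using (0ℓ)
open import Relation.Binary.Core using (Rel)
open import Relation.Binary.Construct.Closure.ReflexiveTransitive using (Star)
open import Relation.Binary.Definitions using (Symmetric; Decidable; Irreflexive)
open import Relation.Binary.PropositionalEquality.Core
  using (_≡_; refl; sym; cong; subst)
open import Relation.Binary.PropositionalEquality.Properties using (module ≡-Reasoning)
open import Relation.Binary.Structures using (IsEquivalence)
open import Relation.Nullary.Decidable using (does; _×-dec_)
open import Relation.Nullary.Negation using (¬_)

private

  abstract

    half : ℚ → ℚ
    half ε = ½ ℚ.* ε

    0<half : ∀ {ε} → 0ℚ ℚ.< ε → 0ℚ ℚ.< half ε
    0<half {ε} 0<ε =
      subst (ℚ._< half ε) (ℚ.*-zeroʳ ½) (ℚ.*-monoʳ-<-pos ½ 0<ε)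

    half+half : ∀ ε → half ε ℚ.+ half ε ≡ ε
    half+half = solve 1 (λ e → con ½ :* e :+ con ½ :* e := e) refl
      where open +-*-Solver

    split< : ∀ q r {p ε} → p ℚ.≤ q ℚ.+ r → q ℚ.< half ε → r ℚ.< half ε → p ℚ.< ε
    split< q r {p} {ε} p≤q+r q< r< =
      ℚ.≤-<-trans p≤q+r
        (subst (q ℚ.+ r ℚ.<_) (half+half ε) (ℚ.+-mono-< q< r<))

    ∣p-p∣≡0 : ∀ p → ∣ p ℚ.- p ∣ ≡ 0ℚ
    ∣p-p∣≡0 p = cong ∣_∣ (ℚ.+-inverseʳ p)

    ∣p-q∣≡∣q-p∣ : ∀ p q → ∣ p ℚ.- q ∣ ≡ ∣ q ℚ.- p ∣
    ∣p-q∣≡∣q-p∣ p q rewrite sym (ℚ.∣-p∣≡∣p∣ (q ℚ.- p)) =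
      cong ∣_∣ (solve 2 (λ p q → p :- q := :- (q :- p)) refl p q)
      where open +-*-Solver

    triangle : ∀ p q r → ∣ p ℚ.- r ∣ ℚ.≤ ∣ p ℚ.- q ∣ ℚ.+ ∣ q ℚ.- r ∣
    triangle p q r = subst (λ z → ∣ z ∣ ℚ.≤ ∣ p ℚ.- q ∣ ℚ.+ ∣ q ℚ.- r ∣)
      (solve 3 (λ p q r → (p :- q) :+ (q :- r) := p :- r) refl p q r)
      (ℚ.∣p+q∣≤∣p∣+∣q∣ (p ℚ.- q) (q ℚ.- r))
      where open +-*-Solver

    +-estimate : ∀ a b c d →
      ∣ (a ℚ.+ b) ℚ.- (c ℚ.+ d) ∣ ℚ.≤ ∣ a ℚ.- c ∣ ℚ.+ ∣ b ℚ.- d ∣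
    +-estimate a b c d = subst (λ z → ∣ z ∣ ℚ.≤ ∣ a ℚ.- c ∣ ℚ.+ ∣ b ℚ.- d ∣)
      (solve 4 (λ a b c d → (a :- c) :+ (b :- d) := (a :+ b) :- (c :+ d)) refl a b c d)
      (ℚ.∣p+q∣≤∣p∣+∣q∣ (a ℚ.- c) (b ℚ.- d))
      where open +-*-Solver

    neg-estimate : ∀ a b → ∣ ℚ.- a ℚ.- ℚ.- b ∣ ≡ ∣ a ℚ.- b ∣
    neg-estimate a b rewrite ∣p-q∣≡∣q-p∣ a b =
      cong ∣_∣ (solve 2 (λ a b → :- a :- :- b := b :- a) refl a b)
      where open +-*-Solver

    *-estimate : ∀ a b c d → ∣ a ℚ.* b ℚ.- c ℚ.* d ∣ ℚ.≤
      ∣ a ∣ ℚ.* ∣ b ℚ.- d ∣ ℚ.+ ∣ d ∣ ℚ.* ∣ a ℚ.- c ∣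
    *-estimate a b c d
      rewrite sym (ℚ.∣p*q∣≡∣p∣*∣q∣ a (b ℚ.- d))
            | sym (ℚ.∣p*q∣≡∣p∣*∣q∣ d (a ℚ.- c)) =
      subst (λ z → ∣ z ∣ ℚ.≤ ∣ a ℚ.* (b ℚ.- d) ∣ ℚ.+ ∣ d ℚ.* (a ℚ.- c) ∣)
        (solve 4 (λ a b c d → a :* (b :- d) :+ d :* (a :- c) := a :* b :- c :* d)
          refl a b c d)
        (ℚ.∣p+q∣≤∣p∣+∣q∣ (a ℚ.* (b ℚ.- d)) (d ℚ.* (a ℚ.- c)))
      where open +-*-Solver

    module _ (K : ℚ) .{{K>0 : Positive K}} where

      private instance
        K≢0 : ℚ.NonZero K
        K≢0 = ℚ.pos⇒nonZero K

      scaled : ℚ → ℚ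
      scaled ε = 1/ K ℚ.* half ε

      0<scaled : ∀ {ε} → 0ℚ ℚ.< ε → 0ℚ ℚ.< scaled ε
      0<scaled {ε} 0<ε = subst (ℚ._< scaled ε) (ℚ.*-zeroʳ (1/ K))
        (ℚ.*-monoʳ-<-pos (1/ K) {{ℚ.1/pos⇒pos K}} (0<half 0<ε))

      K*scaled : ∀ ε → K ℚ.* scaled ε ≡ half ε
      K*scaled ε = begin
        K ℚ.* (1/ K ℚ.* half ε)  ≡⟨ ℚ.*-assoc K (1/ K) (half ε) ⟨
        K ℚ.* 1/ K ℚ.* half ε    ≡⟨ cong (ℚ._* half ε) (ℚ.*-inverseʳ K) ⟩
        1ℚ ℚ.* half ε            ≡⟨ ℚ.*-identityˡ (half ε) ⟩
        half ε                   ∎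
        where open ≡-Reasoning

      term< : ∀ p q {ε} → ∣ p ∣ ℚ.≤ K → ∣ q ∣ ℚ.< scaled ε →
              ∣ p ∣ ℚ.* ∣ q ∣ ℚ.< half ε
      term< p q {ε} p≤K q< = ℚ.≤-<-trans
        (ℚ.*-monoʳ-≤-nonNeg ∣ q ∣ {{ℚ.∣-∣-nonNeg q}} p≤K)
        (subst (K ℚ.* ∣ q ∣ ℚ.<_) (K*scaled ε) (ℚ.*-monoʳ-<-pos K q<))

      *-close : ∀ a b c d {ε} → ∣ a ∣ ℚ.≤ K → ∣ d ∣ ℚ.≤ K →
        ∣ a ℚ.- c ∣ ℚ.< scaled ε → ∣ b ℚ.- d ∣ ℚ.< scaled ε →
        ∣ a ℚ.* b ℚ.- c ℚ.* d ∣ ℚ.< ε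
      *-close a b c d a≤K d≤K ac bd =
        split< (∣ a ∣ ℚ.* ∣ b ℚ.- d ∣) (∣ d ∣ ℚ.* ∣ a ℚ.- c ∣) (*-estimate a b c d)
          (term< a (b ℚ.- d) a≤K bd) (term< d (a ℚ.- c) d≤K ac)

IsCauchy : (ℕ → ℚ) → Set
IsCauchy x = ∀ ε → 0ℚ ℚ.< ε →
  Σ[ N ∈ ℕ ] (∀ m n → N ℕ.≤ m → N ℕ.≤ n → ∣ x m ℚ.- x n ∣ ℚ.< ε)

record ℝ : Set where
  constructor mkℝ
  field
    seq    : ℕ → ℚ
    cauchy : IsCauchy seq

open ℝ public

infix 4 _≈_

-- The difference of the two sequences tends to 0.
_≈_ : Rel ℝ 0ℓ
x ≈ y = ∀ ε → 0ℚ ℚ.< ε →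
  Σ[ N ∈ ℕ ] (∀ n → N ℕ.≤ n → ∣ seq x n ℚ.- seq y n ∣ ℚ.< ε)

private

  ⊔ˡ : ∀ {M N n} → M ⊔ N ℕ.≤ n → M ℕ.≤ n
  ⊔ˡ {M} {N} = ℕ.m⊔n≤o⇒m≤o M N

  ⊔ʳ : ∀ {M N n} → M ⊔ N ℕ.≤ n → N ℕ.≤ n
  ⊔ʳ {M} {N} = ℕ.m⊔n≤o⇒n≤o M N

  EventuallyBounded : (ℕ → ℚ) → ℚ → ℕ → Set
  EventuallyBounded x K N = ∀ n → N ℕ.≤ n → ∣ x n ∣ ℚ.≤ K

  abstract

    bounded : (x : ℝ) → Σ[ K ∈ ℚ ] (0ℚ ℚ.< K × (∃ λ N → EventuallyBounded (seq x) K N))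
    bounded x with cauchy x 1ℚ (ℚ.positive⁻¹ 1ℚ)
    ... | N , close = 1ℚ ℚ.+ ∣ seq x N ∣
                    , ℚ.+-mono-<-≤ (ℚ.positive⁻¹ 1ℚ) (ℚ.0≤∣p∣ (seq x N))
                    , N , bound
      where
      open +-*-Solver
      bound : EventuallyBounded (seq x) (1ℚ ℚ.+ ∣ seq x N ∣) N
      bound n N≤n = ℚ.≤-trans
        (subst (λ z → ∣ z ∣ ℚ.≤ ∣ seq x n ℚ.- seq x N ∣ ℚ.+ ∣ seq x N ∣)
          (solve 2 (λ p q → (p :- q) :+ q := p) refl (seq x n) (seq x N))
          (ℚ.∣p+q∣≤∣p∣+∣q∣ (seq x n ℚ.- seq x N) (seq x N)))
        (ℚ.+-monoˡ-≤ ∣ seq x N ∣ (ℚ.<⇒≤ (close n N N≤n ℕ.≤-refl)))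

    bounded₂ : (x y : ℝ) → Σ[ K ∈ ℚ ] (Positive K ×
      (∃ λ N → EventuallyBounded (seq x) K N × EventuallyBounded (seq y) K N))
    bounded₂ x y =
      let K , 0<K , M , x≤ = bounded x
          L , _   , N , y≤ = bounded y
      in K ℚ.⊔ L
      , positive (ℚ.<-≤-trans 0<K (ℚ.p≤p⊔q K L))
      , M ⊔ N
      , (λ n le → ℚ.≤-trans (x≤ n (⊔ˡ {M} {N} le)) (ℚ.p≤p⊔q K L))
      , (λ n le → ℚ.≤-trans (y≤ n (⊔ʳ {M} {N} le)) (ℚ.p≤q⊔p K L))

infixl 6 _+_
infixl 7 _*_
infix  8 -_

fromℚ : ℚ → ℝ
fromℚ q = mkℝ (λ _ → q) λ ε 0<ε →
  0 , λ _ _ _ _ → subst (ℚ._< ε) (sym (∣p-p∣≡0 q)) 0<ε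

0ℝ 1ℝ : ℝ
0ℝ = fromℚ 0ℚ
1ℝ = fromℚ 1ℚ

_+_ : ℝ → ℝ → ℝ
x + y = mkℝ (λ n → seq x n ℚ.+ seq y n) +-cauchy
  where
  +-cauchy : IsCauchy (λ n → seq x n ℚ.+ seq y n)
  +-cauchy ε 0<ε
    with cauchy x (half ε) (0<half 0<ε) | cauchy y (half ε) (0<half 0<ε)
  ... | M , x-close | N , y-close = M ⊔ N , λ m n le₁ le₂ →
    split< ∣ seq x m ℚ.- seq x n ∣ ∣ seq y m ℚ.- seq y n ∣
      (+-estimate (seq x m) (seq y m) (seq x n) (seq y n))
      (x-close m n (⊔ˡ {M} {N} le₁) (⊔ˡ {M} {N} le₂))
      (y-close m n (⊔ʳ {M} {N} le₁) (⊔ʳ {M} {N} le₂))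

-_ : ℝ → ℝ
- x = mkℝ (λ n → ℚ.- seq x n) -‿cauchy
  where
  -‿cauchy : IsCauchy (λ n → ℚ.- seq x n)
  -‿cauchy ε 0<ε with cauchy x ε 0<ε
  ... | N , close = N , λ m n le₁ le₂ →
    subst (ℚ._< ε) (sym (neg-estimate (seq x m) (seq x n))) (close m n le₁ le₂)

_*_ : ℝ → ℝ → ℝ
x * y = mkℝ (λ n → seq x n ℚ.* seq y n) *-cauchy
  where
  *-cauchy : IsCauchy (λ n → seq x n ℚ.* seq y n)
  *-cauchy ε 0<ε with bounded₂ x y
  ... | K , K>0 , B , x≤ , y≤
    with cauchy x (scaled K {{K>0}} ε) (0<scaled K {{K>0}} 0<ε)
       | cauchy y (scaled K {{K>0}} ε) (0<scaled K {{K>0}} 0<ε)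
  ... | M , x-close | N , y-close = B ⊔ (M ⊔ N) , λ m n le₁ le₂ →
    let le₁′ = ⊔ʳ {B} {M ⊔ N} le₁
        le₂′ = ⊔ʳ {B} {M ⊔ N} le₂
    in *-close K {{K>0}} (seq x m) (seq y m) (seq x n) (seq y n)
         (x≤ m (⊔ˡ {B} {M ⊔ N} le₁)) (y≤ n (⊔ˡ {B} {M ⊔ N} le₂))
         (x-close m n (⊔ˡ {M} {N} le₁′) (⊔ˡ {M} {N} le₂′))
         (y-close m n (⊔ʳ {M} {N} le₁′) (⊔ʳ {M} {N} le₂′))

pointwise⇒≈ : ∀ {x y} → (∀ n → seq x n ≡ seq y n) → x ≈ y
pointwise⇒≈ {x} {y} eq ε 0<ε = 0 , λ n _ →
  subst (λ q → ∣ seq x n ℚ.- q ∣ ℚ.< ε) (eq n)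
    (subst (ℚ._< ε) (sym (∣p-p∣≡0 (seq x n))) 0<ε)

≈-isEquivalence : IsEquivalence _≈_
≈-isEquivalence = record
  { refl  = λ {x} → pointwise⇒≈ {x} {x} (λ _ → refl)
  ; sym   = λ {x} {y} → ≈-sym {x} {y}
  ; trans = λ {x} {y} {z} → ≈-trans {x} {y} {z}
  }
  where
  ≈-sym : ∀ {x y} → x ≈ y → y ≈ x
  ≈-sym {x} {y} x≈y ε 0<ε with x≈y ε 0<ε
  ... | N , close = N , λ n le →
    subst (ℚ._< ε) (∣p-q∣≡∣q-p∣ (seq x n) (seq y n)) (close n le)

  ≈-trans : ∀ {x y z} → x ≈ y → y ≈ z → x ≈ z
  ≈-trans {x} {y} {z} x≈y y≈z ε 0<ε
    with x≈y (half ε) (0<half 0<ε) | y≈z (half ε) (0<half 0<ε)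
  ... | M , xy | N , yz = M ⊔ N , λ n le →
    split< ∣ seq x n ℚ.- seq y n ∣ ∣ seq y n ℚ.- seq z n ∣
      (triangle (seq x n) (seq y n) (seq z n))
      (xy n (⊔ˡ {M} {N} le)) (yz n (⊔ʳ {M} {N} le))

+-cong : ∀ {x x′ y y′} → x ≈ x′ → y ≈ y′ → x + y ≈ x′ + y′
+-cong {x} {x′} {y} {y′} x≈ y≈ ε 0<ε
  with x≈ (half ε) (0<half 0<ε) | y≈ (half ε) (0<half 0<ε)
... | M , x-close | N , y-close = M ⊔ N , λ n le →
  split< ∣ seq x n ℚ.- seq x′ n ∣ ∣ seq y n ℚ.- seq y′ n ∣
    (+-estimate (seq x n) (seq y n) (seq x′ n) (seq y′ n))
    (x-close n (⊔ˡ {M} {N} le)) (y-close n (⊔ʳ {M} {N} le))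

-‿cong : ∀ {x x′} → x ≈ x′ → - x ≈ - x′
-‿cong {x} {x′} x≈ ε 0<ε with x≈ ε 0<ε
... | N , close = N , λ n le →
  subst (ℚ._< ε) (sym (neg-estimate (seq x n) (seq x′ n))) (close n le)

*-cong : ∀ {x x′ y y′} → x ≈ x′ → y ≈ y′ → x * y ≈ x′ * y′
*-cong {x} {x′} {y} {y′} x≈ y≈ ε 0<ε with bounded₂ x y′
... | K , K>0 , B , x≤ , y′≤
  with x≈ (scaled K {{K>0}} ε) (0<scaled K {{K>0}} 0<ε)
     | y≈ (scaled K {{K>0}} ε) (0<scaled K {{K>0}} 0<ε)
... | M , x-close | N , y-close = B ⊔ (M ⊔ N) , λ n le →
  let le′ = ⊔ʳ {B} {M ⊔ N} le
  in *-close K {{K>0}} (seq x n) (seq y n) (seq x′ n) (seq y′ n)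
       (x≤ n (⊔ˡ {B} {M ⊔ N} le)) (y′≤ n (⊔ˡ {B} {M ⊔ N} le))
       (x-close n (⊔ˡ {M} {N} le′)) (y-close n (⊔ʳ {M} {N} le′))

private
  module Seq =
    CommutativeRing (Pointwise.commutativeRing ℕ ℚ.+-*-commutativeRing)

ℝ-commutativeRing : CommutativeRing 0ℓ 0ℓ
ℝ-commutativeRing = record
  { Carrier = ℝ ; _≈_ = _≈_ ; _+_ = _+_ ; _*_ = _*_ ; -_ = -_ ; 0# = 0ℝ ; 1# = 1ℝ
  ; isCommutativeRing = record
    { isRing = record
      { +-isAbelianGroup = record
        { isGroup = record
          { isMonoid = record
            { isSemigroup = record
              { isMagma = record
                { isEquivalence = ≈-isEquivalence
                ; ∙-cong = λ {x} {x′} {y} {y′} → +-cong {x} {x′} {y} {y′}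
                }
              ; assoc = λ x y z → pointwise⇒≈ {(x + y) + z} {x + (y + z)}
                  (Seq.+-assoc (seq x) (seq y) (seq z))
              }
            ; identity =
                (λ x → pointwise⇒≈ {0ℝ + x} {x} (Seq.+-identityˡ (seq x)))
              , (λ x → pointwise⇒≈ {x + 0ℝ} {x} (Seq.+-identityʳ (seq x)))
            }
          ; inverse =
              (λ x → pointwise⇒≈ { - x + x} {0ℝ} (Seq.-‿inverseˡ (seq x)))
            , (λ x → pointwise⇒≈ {x + - x} {0ℝ} (Seq.-‿inverseʳ (seq x)))
          ; ⁻¹-cong = λ {x} {x′} → -‿cong {x} {x′}
          }
        ; comm = λ x y → pointwise⇒≈ {x + y} {y + x} (Seq.+-comm (seq x) (seq y))
        }
      ; *-cong = λ {x} {x′} {y} {y′} → *-cong {x} {x′} {y} {y′}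
      ; *-assoc = λ x y z → pointwise⇒≈ {(x * y) * z} {x * (y * z)}
          (Seq.*-assoc (seq x) (seq y) (seq z))
      ; *-identity =
          (λ x → pointwise⇒≈ {1ℝ * x} {x} (Seq.*-identityˡ (seq x)))
        , (λ x → pointwise⇒≈ {x * 1ℝ} {x} (Seq.*-identityʳ (seq x)))
      ; distrib =
          (λ x y z → pointwise⇒≈ {x * (y + z)} {x * y + x * z}
            (Seq.distribˡ (seq x) (seq y) (seq z)))
        , (λ x y z → pointwise⇒≈ {(y + z) * x} {y * x + z * x}
            (Seq.distribʳ (seq x) (seq y) (seq z)))
      }
    ; *-comm = λ x y → pointwise⇒≈ {x * y} {y * x} (Seq.*-comm (seq x) (seq y))
    }
  }

open CommutativeRing ℝ-commutativeRing public using (_≉_; _-_)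

2ℝ : ℝ
2ℝ = 1ℝ + 1ℝ

open RawMonoidDefinitions (CommutativeRing.+-rawMonoid ℝ-commutativeRing)
  using (sum) renaming (_×_ to _·_)

Matrix : ℕ → Set
Matrix n = Fin n → Fin n → ℝ

infixl 7 _*ᵥ_

_*ᵥ_ : ∀ {n} → Matrix n → Vector ℝ n → Vector ℝ n
(M *ᵥ X) i = sum (λ j → M i j * X j)

IsEigenvector : ∀ {n} → Matrix n → ℝ → Vector ℝ n → Set
IsEigenvector M μ X =
  ¬ (∀ i → X i ≈ 0ℝ) × (∀ i → (M *ᵥ X) i ≈ μ * X i)

IsEigenvalue : ∀ {n} → Matrix n → ℝ → Set
IsEigenvalue M μ = ∃ λ X → IsEigenvector M μ X

record Graph (n : ℕ) : Set₁ where
  infix 4 _~_ _~?_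
  field
    _~_      : Rel (Fin n) 0ℓ
    _~?_     : Decidable _~_
    ~-sym    : Symmetric _~_
    ~-irrefl : Irreflexive _≡_ _~_

module _ {n : ℕ} (G : Graph n) where
  open Graph G

  degree : Fin n → ℕ
  degree i = length (filter (i ~?_) (allFin n))

  -- Each edge is listed once, as its pair of endpoints in increasing order.
  edges : List (Fin n × Fin n)
  edges = filter (λ (i , j) → (i Fin.<? j) ×-dec (i ~? j))
    (cartesianProduct (allFin n) (allFin n))

  degreeMatrix : Matrix n
  degreeMatrix i j = if does (i Fin.≟ j) then degree i · 1ℝ else 0ℝ

  adjacencyMatrix : Matrix n
  adjacencyMatrix i j = if does (i ~? j) then 1ℝ else 0ℝ

  laplacian : Matrix n
  laplacian i j = degreeMatrix i j - adjacencyMatrix i j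

  Connected : Set
  Connected = NonZero n × (∀ i j → Star _~_ i j)

  Unicyclic : Set
  Unicyclic = Connected × length edges ≡ n

  -- A set of edges, given as a symmetric subrelation of adjacency, such that
  -- every vertex is an endpoint of exactly one of them.
  record PerfectMatching : Set₁ where
    field
      Matched     : Rel (Fin n) 0ℓ
      matched-sym : Symmetric Matched
      matched⇒~   : ∀ {i j} → Matched i j → i ~ j
      covers      : ∀ i → ∃! _≡_ (Matched i)

{-# OPTIONS --safe #-}
module Submission where

-- Give an edge the sign −1 if it lies in the perfect matching and +1 otherwise, and let ∇ be the
-- signed incidence matrix, (∇ x)(ij) = x i − s i j · x j.  Every vertex is on exactly one matched
-- edge, so L − 2I = ∇ᵀ diag(s) ∇.  In a unicyclic graph ∇ is a square rational matrix.  If it is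
-- singular, it kills a nonzero rational vector.  Otherwise ∇ is onto over ℚ, hence ∇ᵀ is injective
-- over ℝ and (L − 2I) X = 0 gives ∇ X = 0.  Either way some nonzero real X has ∇ X = 0; this X
-- is an eigenvector, and its entries agree up to sign along edges, hence everywhere.

open import Defs
open import Algebra.Bundles using (CommutativeRing)
import Algebra.Definitions.RawMonoid as RawMonoid
import Algebra.Properties.Group as GroupProperties
import Algebra.Properties.Semiring.Sum as SemiringSum
open import Data.Bool.Base using (Bool; true; false; if_then_else_; _∧_)
open import Data.Bool.Properties using (if-float)
open import Data.Fin.Base using (Fin; zero; suc; punchIn; punchOut)
import Data.Fin.Base as Fin
import Data.Fin.Properties as Fin
open import Data.List.Base
  using (List; []; _∷_; _++_; length; filter; map; foldr; lookup; tabulate; allFin;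
         cartesianProduct)
open import Data.List.Membership.Propositional using (_∈_)
open import Data.List.Membership.Propositional.Properties
  using (∈-filter⁺; ∈-cartesianProduct⁺; ∈-allFin)
open import Data.List.Relation.Unary.Any using (index)
open import Data.List.Relation.Unary.Any.Properties using (lookup-index)
open import Data.Nat.Base using (ℕ; zero; suc)
open import Data.Nat.Properties using (≤-refl)
open import Data.Product.Base using (Σ-syntax; ∃; _×_; _,_; proj₁; proj₂)
open import Data.Rational.Base using (ℚ; 0ℚ; 1ℚ; 1/_)
import Data.Rational.Base as ℚ
import Data.Rational.Properties as ℚ
open import Data.Rational.Solver using (module +-*-Solver)
open import Data.Sum.Base using (_⊎_; inj₁; inj₂; [_,_]′)
open import Data.Vec.Functional using (Vector) renaming (_∷_ to _◂_)
open import Function.Base using (_∘_; id)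
open import Function.Bundles using (mk⇔)
open import Level using (0ℓ)
open import Relation.Binary.Construct.Closure.ReflexiveTransitive using (Star; fold)
open import Relation.Binary.Definitions using (tri<; tri≈; tri>)
open import Relation.Binary.PropositionalEquality
  using (_≡_; _≢_; refl; sym; trans; cong; cong₂; subst; module ≡-Reasoning)
open import Relation.Nullary using (¬_; yes; no; does; contradiction; ¬?; _×-dec_)
open import Relation.Nullary.Decidable using (decidable-stable; does-⇔; dec-true; dec-false)
open import Relation.Unary using (Pred; Decidable)

-- Linear algebra over ℚ: Gaussian elimination and the Fredholm alternative.

module ℚΣ = SemiringSum (CommutativeRing.semiring ℚ.+-*-commutativeRing)
open ℚΣ using (sum)
open +-*-Solver using (solve; _:=_; _:+_; _:*_; _:-_; :-_; con)

_·_ : ∀ {m n} → (Fin m → Fin n → ℚ) → Vector ℚ n → Vector ℚ m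
(A · x) i = sum λ j → A i j ℚ.* x j

sum-zeroʳ : ∀ {n} (c : Vector ℚ n) → sum (λ j → c j ℚ.* 0ℚ) ≡ 0ℚ
sum-zeroʳ {n} c = trans (ℚΣ.sum-cong-≗ (ℚ.*-zeroʳ ∘ c)) (ℚΣ.sum-replicate-zero n)

sum-combine : ∀ {n} c (f g : Vector ℚ n) →
  sum (λ j → f j ℚ.+ c ℚ.* g j) ≡ sum f ℚ.+ c ℚ.* sum g
sum-combine c f g = trans (ℚΣ.∑-distrib-+ f _)
  (cong (sum f ℚ.+_) (sym (ℚΣ.*-distribˡ-sum c g)))

module Elimination {n} (A : Fin (suc n) → Fin (suc n) → ℚ) (p : Fin (suc n))
  (pivot≢0 : A p zero ≢ 0ℚ) where

  open ≡-Reasoning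
  instance _ = ℚ.≢-nonZero pivot≢0

  factor : Fin n → ℚ
  factor i = A (punchIn p i) zero ℚ.* 1/ A p zero

  -- Schur complement of the pivot `A p zero`: the rows other than `p` after column zero has been
  -- cleared.
  reduced : Fin n → Fin n → ℚ
  reduced i j = A (punchIn p i) (suc j) ℚ.- factor i ℚ.* A p (suc j)

  -- Back substitution: row `p` of `A x = b` determines the first coordinate from the others.
  extend : Vector ℚ (suc n) → Vector ℚ n → Vector ℚ (suc n)
  extend b x = (1/ A p zero ℚ.* (b p ℚ.- sum λ j → A p (suc j) ℚ.* x j)) ◂ x

  -- Row `p` holds by the choice of the first coordinate. Every other row of `A` is `factor` times
  -- row `p` plus a row of `reduced` with a zero put in front, and the right-hand side is reduced in
  -- the same way.
  extend-solves : ∀ b x →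
    (∀ i → (reduced · x) i ≡ b (punchIn p i) ℚ.- factor i ℚ.* b p) →
    ∀ i → (A · extend b x) i ≡ b i
  extend-solves b x solves i with p Fin.≟ i
  ... | yes refl = begin
    A p zero ℚ.* (1/ A p zero ℚ.* (b p ℚ.- s)) ℚ.+ s
      ≡⟨ cong (ℚ._+ s) (ℚ.*-assoc (A p zero) _ _) ⟨
    A p zero ℚ.* 1/ A p zero ℚ.* (b p ℚ.- s) ℚ.+ s
      ≡⟨ cong (λ z → z ℚ.* (b p ℚ.- s) ℚ.+ s) (ℚ.*-inverseʳ (A p zero)) ⟩
    1ℚ ℚ.* (b p ℚ.- s) ℚ.+ s
      ≡⟨ solve 2 (λ b s → con 1ℚ :* (b :- s) :+ s := b) refl (b p) s ⟩
    b p ∎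
    where s = sum λ j → A p (suc j) ℚ.* x j
  ... | no p≢i = subst (λ i → (A · extend b x) i ≡ b i) (Fin.punchIn-punchOut p≢i) (begin
    a ℚ.* (1/ A p zero ℚ.* (b p ℚ.- s)) ℚ.+ sum (λ j → A p′ (suc j) ℚ.* x j)
      ≡⟨ cong₂ ℚ._+_ (sym (ℚ.*-assoc a _ _)) (ℚΣ.sum-cong-≗ λ j →
           solve 4 (λ u c v x → u :* x := (u :- c :* v) :* x :+ c :* (v :* x))
             refl (A p′ (suc j)) (factor k) (A p (suc j)) (x j)) ⟩
    factor k ℚ.* (b p ℚ.- s) ℚ.+
      sum (λ j → reduced k j ℚ.* x j ℚ.+ factor k ℚ.* (A p (suc j) ℚ.* x j))
      ≡⟨ cong (factor k ℚ.* (b p ℚ.- s) ℚ.+_)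
           (sum-combine (factor k) (λ j → reduced k j ℚ.* x j) _) ⟩
    factor k ℚ.* (b p ℚ.- s) ℚ.+ ((reduced · x) k ℚ.+ factor k ℚ.* s)
      ≡⟨ cong (λ z → factor k ℚ.* (b p ℚ.- s) ℚ.+ (z ℚ.+ factor k ℚ.* s)) (solves k) ⟩
    factor k ℚ.* (b p ℚ.- s) ℚ.+ (b p′ ℚ.- factor k ℚ.* b p ℚ.+ factor k ℚ.* s)
      ≡⟨ solve 4 (λ c b s b′ → c :* (b :- s) :+ (b′ :- c :* b :+ c :* s) := b′)
           refl (factor k) (b p) s (b p′) ⟩
    b p′ ∎)
    where
    k = punchOut p≢i
    p′ = punchIn p k
    a = A p′ zero
    s = sum λ j → A p (suc j) ℚ.* x j

Singular Surjective : ∀ {m n} → (Fin m → Fin n → ℚ) → Set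
Singular {n = n} A =
  Σ[ z ∈ Vector ℚ n ] ((∃ λ i → z i ≢ 0ℚ) × (∀ i → (A · z) i ≡ 0ℚ))
Surjective {m} {n} A =
  (b : Vector ℚ m) → Σ[ x ∈ Vector ℚ n ] (∀ i → (A · x) i ≡ b i)

-- Induction on the size. If column zero vanishes, the first unit vector lies in the kernel;
-- otherwise `extend-solves` lifts either alternative from the Schur complement. The pivot search
-- relies on decidable equality, hence the work over ℚ. Rows and columns are counted separately
-- because they will be edges and vertices, whose numbers agree only by a proof.
fredholm : ∀ {m n} → m ≡ n → (A : Fin m → Fin n → ℚ) → Singular A ⊎ Surjective A
fredholm {zero}  refl A = inj₂ λ b → (λ ()) , λ ()
fredholm {suc n} refl A with Fin.any? (λ p → ¬? (A p zero ℚ.≟ 0ℚ))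
... | no column≡0 = inj₁
  (1ℚ ◂ (λ _ → 0ℚ) , (zero , ℚ.1≢0) , λ i → begin
    A i zero ℚ.* 1ℚ ℚ.+ sum (λ j → A i (suc j) ℚ.* 0ℚ)
      ≡⟨ cong₂ ℚ._+_ (ℚ.*-identityʳ (A i zero)) (sum-zeroʳ (A i ∘ suc)) ⟩
    A i zero ℚ.+ 0ℚ
      ≡⟨ ℚ.+-identityʳ (A i zero) ⟩
    A i zero
      ≡⟨ decidable-stable (A i zero ℚ.≟ 0ℚ) (λ ≢0 → column≡0 (i , ≢0)) ⟩
    0ℚ ∎)
  where
  open ≡-Reasoning
... | yes (p , pivot≢0) with fredholm refl (Elimination.reduced A p pivot≢0)
...   | inj₁ (z , (i , zᵢ≢0) , z∈ker) = inj₁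
  (extend 0̂ z , (suc i , zᵢ≢0) , extend-solves 0̂ z λ k →
    trans (z∈ker k) (solve 1 (λ c → con 0ℚ := con 0ℚ :- c :* con 0ℚ) refl (factor k)))
  where
  open Elimination A p pivot≢0
  0̂ : Vector ℚ (suc n)
  0̂ _ = 0ℚ
...   | inj₂ surj = inj₂ λ b →
  let x , solves = surj λ k → b (punchIn p k) ℚ.- factor k ℚ.* b p
  in extend b x , extend-solves b x solves
  where open Elimination A p pivot≢0

-- Indicators, and double sums over ordered and unordered pairs.

[_] : Bool → ℚ
[ b ] = if b then 1ℚ else 0ℚ

[∧] : ∀ b c → [ b ∧ c ] ≡ [ b ] ℚ.* [ c ]
[∧] false c = sym (ℚ.*-zeroˡ [ c ])
[∧] true  c = sym (ℚ.*-identityˡ [ c ])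

sum-δ : ∀ {n} (k : Fin n) (f : Vector ℚ n) → sum (λ j → [ does (k Fin.≟ j) ] ℚ.* f j) ≡ f k
sum-δ zero f = begin
  1ℚ ℚ.* f zero ℚ.+ sum (λ j → 0ℚ ℚ.* f (suc j))
    ≡⟨ cong₂ ℚ._+_ (sym (ℚ.*-identityˡ (f zero))) (ℚΣ.*-distribˡ-sum 0ℚ (f ∘ suc)) ⟨
  f zero ℚ.+ 0ℚ ℚ.* sum (f ∘ suc)
    ≡⟨ solve 2 (λ a b → a :+ con 0ℚ :* b := a) refl (f zero) (sum (f ∘ suc)) ⟩
  f zero ∎
  where open ≡-Reasoning
sum-δ (suc k) f = begin
  0ℚ ℚ.* f zero ℚ.+ sum (λ j → [ does (k Fin.≟ j) ] ℚ.* f (suc j))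
    ≡⟨ cong₂ ℚ._+_ (ℚ.*-zeroˡ (f zero)) (sum-δ k (f ∘ suc)) ⟩
  0ℚ ℚ.+ f (suc k)
    ≡⟨ ℚ.+-identityˡ (f (suc k)) ⟩
  f (suc k) ∎
  where open ≡-Reasoning

sum₂-cong : ∀ {m n} {f g : Fin m → Fin n → ℚ} → (∀ i j → f i j ≡ g i j) →
  sum (λ i → sum (f i)) ≡ sum (λ i → sum (g i))
sum₂-cong f≗g = ℚΣ.sum-cong-≗ λ i → ℚΣ.sum-cong-≗ (f≗g i)

sum₂-distrib-+ : ∀ {m n} (f g : Fin m → Fin n → ℚ) →
  sum (λ i → sum λ j → f i j ℚ.+ g i j) ≡
  sum (λ i → sum (f i)) ℚ.+ sum (λ i → sum (g i))
sum₂-distrib-+ f g = trans (ℚΣ.sum-cong-≗ λ i → ℚΣ.∑-distrib-+ (f i) (g i))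
  (ℚΣ.∑-distrib-+ (sum ∘ f) (sum ∘ g))

-- Exchanging the order of summation in the `g j i` half attaches to `g i j` the two indicators of i
-- < j and j < i. Off the diagonal exactly one of them is 1; on the diagonal `g` vanishes.
sum-unordered : ∀ {n} (g : Fin n → Fin n → ℚ) → (∀ i → g i i ≡ 0ℚ) →
  sum (λ i → sum λ j → [ does (i Fin.<? j) ] ℚ.* (g i j ℚ.+ g j i)) ≡
  sum (λ i → sum (g i))
sum-unordered g diag = begin
  sum (λ i → sum λ j → < i , j > ℚ.* (g i j ℚ.+ g j i))
    ≡⟨ sum₂-cong (λ i j → ℚ.*-distribˡ-+ < i , j > (g i j) (g j i)) ⟩
  sum (λ i → sum λ j → < i , j > ℚ.* g i j ℚ.+ < i , j > ℚ.* g j i)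
    ≡⟨ sum₂-distrib-+ (λ i j → < i , j > ℚ.* g i j) _ ⟩
  sum (λ i → sum λ j → < i , j > ℚ.* g i j) ℚ.+
    sum (λ i → sum λ j → < i , j > ℚ.* g j i)
    ≡⟨ cong (sum (λ i → sum λ j → < i , j > ℚ.* g i j) ℚ.+_)
         (ℚΣ.∑-comm (λ i j → < i , j > ℚ.* g j i)) ⟩
  sum (λ i → sum λ j → < i , j > ℚ.* g i j) ℚ.+
    sum (λ i → sum λ j → < j , i > ℚ.* g i j)
    ≡⟨ sum₂-distrib-+ (λ i j → < i , j > ℚ.* g i j) _ ⟨
  sum (λ i → sum λ j → < i , j > ℚ.* g i j ℚ.+ < j , i > ℚ.* g i j)
    ≡⟨ sum₂-cong either ⟩
  sum (λ i → sum (g i)) ∎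
  where
  open ≡-Reasoning
  <_,_> : Fin _ → Fin _ → ℚ
  < i , j > = [ does (i Fin.<? j) ]
  either : ∀ i j → < i , j > ℚ.* g i j ℚ.+ < j , i > ℚ.* g i j ≡ g i j
  either i j with Fin.<-cmp i j
  ... | tri< i<j _ i≯j
    rewrite dec-true (i Fin.<? j) i<j | dec-false (j Fin.<? i) i≯j =
    solve 1 (λ x → con 1ℚ :* x :+ con 0ℚ :* x := x) refl (g i j)
  ... | tri> i≮j _ i>j
    rewrite dec-false (i Fin.<? j) i≮j | dec-true (j Fin.<? i) i>j =
    solve 1 (λ x → con 0ℚ :* x :+ con 1ℚ :* x := x) refl (g i j)
  ... | tri≈ _ refl _ rewrite diag i =
    solve 1 (λ x → x :* con 0ℚ :+ x :* con 0ℚ := con 0ℚ) refl < i , i >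

-- Sums over lists, filtered lists and products.

sumₗ : ∀ {A : Set} → (A → ℚ) → List A → ℚ
sumₗ f = foldr (λ x t → f x ℚ.+ t) 0ℚ

sum-lookup : ∀ {A : Set} (f : A → ℚ) xs → sum (f ∘ lookup xs) ≡ sumₗ f xs
sum-lookup f []       = refl
sum-lookup f (x ∷ xs) = cong (f x ℚ.+_) (sum-lookup f xs)

sumₗ-tabulate : ∀ {A : Set} {n} (f : A → ℚ) (g : Fin n → A) →
  sumₗ f (tabulate g) ≡ sum (f ∘ g)
sumₗ-tabulate {n = zero}  f g = refl
sumₗ-tabulate {n = suc n} f g = cong (f (g zero) ℚ.+_) (sumₗ-tabulate f (g ∘ suc))

sumₗ-map : ∀ {A B : Set} (f : B → ℚ) (g : A → B) xs → sumₗ f (map g xs) ≡ sumₗ (f ∘ g) xs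
sumₗ-map f g []       = refl
sumₗ-map f g (x ∷ xs) = cong (f (g x) ℚ.+_) (sumₗ-map f g xs)

sumₗ-++ : ∀ {A : Set} (f : A → ℚ) xs ys → sumₗ f (xs ++ ys) ≡ sumₗ f xs ℚ.+ sumₗ f ys
sumₗ-++ f []       ys = sym (ℚ.+-identityˡ (sumₗ f ys))
sumₗ-++ f (x ∷ xs) ys =
  trans (cong (f x ℚ.+_) (sumₗ-++ f xs ys)) (sym (ℚ.+-assoc (f x) _ _))

sumₗ-cartesianProduct : ∀ {A B : Set} (f : A × B → ℚ) xs ys →
  sumₗ f (cartesianProduct xs ys) ≡ sumₗ (λ x → sumₗ (λ y → f (x , y)) ys) xs
sumₗ-cartesianProduct f []       ys = refl
sumₗ-cartesianProduct f (x ∷ xs) ys = trans (sumₗ-++ f (map (x ,_) ys) _)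
  (cong₂ ℚ._+_ (sumₗ-map f (x ,_) ys) (sumₗ-cartesianProduct f xs ys))

sumₗ-filter : ∀ {A : Set} {P : Pred A 0ℓ} (P? : Decidable P) f xs →
  sumₗ f (filter P? xs) ≡ sumₗ (λ x → [ does (P? x) ] ℚ.* f x) xs
sumₗ-filter P? f []       = refl
sumₗ-filter P? f (x ∷ xs) with does (P? x)
... | true  = cong₂ ℚ._+_ (sym (ℚ.*-identityˡ (f x))) (sumₗ-filter P? f xs)
... | false = trans (sumₗ-filter P? f xs)
  (solve 2 (λ a b → b := con 0ℚ :* a :+ b) refl (f x) _)

sum-allPairs : ∀ {n} (f : Fin n × Fin n → ℚ) →
  sumₗ f (cartesianProduct (allFin n) (allFin n)) ≡ sum (λ i → sum λ j → f (i , j))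
sum-allPairs {n} f = trans (sumₗ-cartesianProduct f (allFin n) (allFin n))
  (trans (sumₗ-tabulate {n = n} (λ i → sumₗ (λ j → f (i , j)) (allFin n)) id)
    (ℚΣ.sum-cong-≗ {n} λ i → sumₗ-tabulate (λ j → f (i , j)) id))

-- Sums of Cauchy reals and embedded rationals.

module ℝΣ = SemiringSum (CommutativeRing.semiring ℝ-commutativeRing)
open RawMonoid (CommutativeRing.+-rawMonoid ℝ-commutativeRing) using () renaming (_×_ to _×ℝ_)

-- Lets a real identity between finite sums be checked at each index `k` as an identity over ℚ.
seq-sum : ∀ {n} (f : Vector ℝ n) k → seq (ℝΣ.sum f) k ≡ sum (λ j → seq (f j) k)
seq-sum {zero}  f k = refl
seq-sum {suc n} f k = cong (seq (f zero) k ℚ.+_) (seq-sum (f ∘ suc) k)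

-- Used to read a vertex degree, which is the length of a filtered list, as a rational sum of
-- adjacency indicators.
seq-count : ∀ {A : Set} {P : Pred A 0ℓ} (P? : Decidable P) xs k →
  seq (length (filter P? xs) ×ℝ 1ℝ) k ≡ sumₗ (λ x → [ does (P? x) ]) xs
seq-count P? []       k = refl
seq-count P? (x ∷ xs) k with does (P? x)
... | true  = cong (1ℚ ℚ.+_) (seq-count P? xs k)
... | false = trans (seq-count P? xs k) (sym (ℚ.+-identityˡ _))

module R = CommutativeRing ℝ-commutativeRing
module RG = GroupProperties R.+-group

sum-≈0 : ∀ {n} (f : Vector ℝ n) → (∀ i → f i ≈ 0ℝ) → ℝΣ.sum f ≈ 0ℝ
sum-≈0 {n} f f≈0 = R.trans {ℝΣ.sum f} {ℝΣ.sum {n} (λ _ → 0ℝ)} {0ℝ}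
  (ℝΣ.sum-cong-≋ {n} {f} {λ _ → 0ℝ} f≈0) (ℝΣ.sum-replicate-zero n)

-- The difference from zero has constant modulus |q|, so for q ≠ 0 the choice ε = |q| would give |q|
-- < |q|.
fromℚ≈0⇒≡0 : ∀ {q} → fromℚ q ≈ 0ℝ → q ≡ 0ℚ
fromℚ≈0⇒≡0 {q} q≈0 with q ℚ.≟ 0ℚ
... | yes q≡0 = q≡0
... | no  q≢0 = contradiction (proj₂ close _ ≤-refl)
  (ℚ.<-irrefl (cong ℚ.∣_∣ (ℚ.+-identityʳ q)))
  where
  0<∣q∣ = ℚ.≰⇒> λ ∣q∣≤0 →
    q≢0 (ℚ.∣p∣≡0⇒p≡0 q (ℚ.≤-antisym ∣q∣≤0 (ℚ.0≤∣p∣ q)))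
  close = q≈0 ℚ.∣ q ∣ 0<∣q∣

-- Signs, and equality of reals up to sign.

sign : Bool → ℚ
sign b = if b then ℚ.- 1ℚ else 1ℚ

infix 4 _≈±_

-- The disjuncts stand in the order of the theorem's conclusion.
_≈±_ : ℝ → ℝ → Set
x ≈± y = x ≈ - y ⊎ x ≈ y

≈±-sym : ∀ {x y} → x ≈± y → y ≈± x
≈±-sym {x} {y} (inj₁ x≈-y) = inj₁ (R.sym { - x} {y}
  (R.trans { - x} { - - y} {y} (R.-‿cong {x} { - y} x≈-y) (RG.⁻¹-involutive y)))
≈±-sym {x} {y} (inj₂ x≈y)  = inj₂ (R.sym {x} {y} x≈y)

≈±-trans : ∀ {x y z} → x ≈± y → y ≈± z → x ≈± z
≈±-trans {x} {y} {z} (inj₂ x≈y) (inj₁ y≈-z) = inj₁ (R.trans {x} {y} { - z} x≈y y≈-z)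
≈±-trans {x} {y} {z} (inj₂ x≈y) (inj₂ y≈z)  = inj₂ (R.trans {x} {y} {z} x≈y y≈z)
≈±-trans {x} {y} {z} (inj₁ x≈-y) (inj₂ y≈z) = inj₁ (R.trans {x} { - y} { - z} x≈-y
  (R.-‿cong {y} {z} y≈z))
≈±-trans {x} {y} {z} (inj₁ x≈-y) (inj₁ y≈-z) = inj₂ (R.trans {x} { - y} {z} x≈-y
  (R.trans { - y} { - - z} {z} (R.-‿cong {y} { - z} y≈-z) (RG.⁻¹-involutive z)))

≈±0⇒≈0 : ∀ {x y} → x ≈± y → y ≈ 0ℝ → x ≈ 0ℝ
≈±0⇒≈0 {x} {y} (inj₁ x≈-y) y≈0 = R.trans {x} { - y} {0ℝ} x≈-y
  (R.trans { - y} { - 0ℝ} {0ℝ} (R.-‿cong {y} {0ℝ} y≈0) RG.ε⁻¹≈ε)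
≈±0⇒≈0 {x} {y} (inj₂ x≈y) y≈0 = R.trans {x} {y} {0ℝ} x≈y y≈0

sign-≈± : ∀ b {x y} → x ≈ fromℚ (sign b) * y → x ≈± y
sign-≈± true  {x} {y} x≈cy = inj₁ (R.trans {x} {fromℚ (ℚ.- 1ℚ) * y} { - y} x≈cy
  (pointwise⇒≈ {fromℚ (ℚ.- 1ℚ) * y} { - y} λ k →
    solve 1 (λ y → con (ℚ.- 1ℚ) :* y := :- y) refl (seq y k)))
sign-≈± false {x} {y} x≈cy = inj₂ (R.trans {x} {1ℝ * y} {y} x≈cy (R.*-identityˡ y))

-- The signing of a graph by a perfect matching, given as an involution along edges.

module SignedGraph {n} (G : Graph n) (match : Fin n → Fin n)
  (match-involutive : ∀ i → match (match i) ≡ i)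
  (match-~ : ∀ i → Graph._~_ G i (match i)) where

  open Graph G
  open ≡-Reasoning

  m : Fin n → Fin n → Bool
  m i j = does (match i Fin.≟ j)

  m-sym : ∀ i j → m i j ≡ m j i
  m-sym i j = does-⇔ (mk⇔ (flip i j) (flip j i)) (match i Fin.≟ j) (match j Fin.≟ i)
    where
    flip : ∀ i j → match i ≡ j → match j ≡ i
    flip i .(match i) refl = match-involutive i

  a s : Fin n → Fin n → ℚ
  a i j = [ does (i ~? j) ]
  s i j = sign (m i j)

  a-sym : ∀ i j → a i j ≡ a j i
  a-sym i j = cong [_] (does-⇔ (mk⇔ ~-sym ~-sym) (i ~? j) (j ~? i))

  -- A matched pair is adjacent, so there the identity reads 1 · (-1) = 1 - 2; elsewhere the sign is
  -- 1 and nothing is subtracted.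
  as≡a-2m : ∀ i j → a i j ℚ.* s i j ≡ a i j ℚ.- ([ m i j ] ℚ.+ [ m i j ])
  as≡a-2m i j with match i Fin.≟ j
  ... | no  _    = solve 1 (λ a → a :* con 1ℚ := a :- (con 0ℚ :+ con 0ℚ)) refl (a i j)
  ... | yes refl rewrite dec-true (i ~? match i) (match-~ i) = refl

  -- The signed gradient and its bilinear form.

  ∇ : Vector ℚ n → Fin n × Fin n → ℚ
  ∇ x (i , j) = x i ℚ.- s i j ℚ.* x j

  -- (L − 2I) x, see laplacian-residual.
  residual : Vector ℚ n → Vector ℚ n
  residual x i = sum λ j → a i j ℚ.* (s i j ℚ.* x i ℚ.- x j)

  sum-edges : ∀ (f : Fin n × Fin n → ℚ) → sum (f ∘ lookup (edges G)) ≡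
    sum (λ i → sum λ j → [ does (i Fin.<? j) ] ℚ.* (a i j ℚ.* f (i , j)))
  sum-edges f = begin
    sum (f ∘ lookup (edges G))
      ≡⟨ sum-lookup f (edges G) ⟩
    sumₗ f (edges G)
      ≡⟨ sumₗ-filter _ f (cartesianProduct (allFin n) (allFin n)) ⟩
    sumₗ (λ (i , j) → [ does (i Fin.<? j) ∧ does (i ~? j) ] ℚ.* f (i , j))
        (cartesianProduct (allFin n) (allFin n))
      ≡⟨ sum-allPairs {n} (λ (i , j) → [ does (i Fin.<? j) ∧ does (i ~? j) ] ℚ.* f (i , j)) ⟩
    sum (λ i → sum λ j → [ does (i Fin.<? j) ∧ does (i ~? j) ] ℚ.* f (i , j))
      ≡⟨ sum₂-cong (λ i j → trans
           (cong (ℚ._* f (i , j)) ([∧] (does (i Fin.<? j)) (does (i ~? j))))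
           (ℚ.*-assoc [ does (i Fin.<? j) ] (a i j) (f (i , j)))) ⟩
    sum (λ i → sum λ j → [ does (i Fin.<? j) ] ℚ.* (a i j ℚ.* f (i , j))) ∎

  -- The bilinear form of L − 2I = ∇ᵀ diag(s) ∇.
  green : ∀ x y → sum (λ i → residual x i ℚ.* y i) ≡
    sum (λ e → (λ (i , j) → s i j ℚ.* (∇ x (i , j) ℚ.* ∇ y (i , j))) (lookup (edges G) e))
  green x y = sym (begin
    sum ((λ (i , j) → s i j ℚ.* (∇ x (i , j) ℚ.* ∇ y (i , j))) ∘ lookup (edges G))
      ≡⟨ sum-edges _ ⟩
    sum (λ i → sum λ j → [ does (i Fin.<? j) ] ℚ.*
      (a i j ℚ.* (s i j ℚ.* (∇ x (i , j) ℚ.* ∇ y (i , j)))))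
      ≡⟨ sum₂-cong (λ i j → cong ([ does (i Fin.<? j) ] ℚ.*_) (expand i j)) ⟩
    sum (λ i → sum λ j → [ does (i Fin.<? j) ] ℚ.* (g i j ℚ.+ g j i))
      ≡⟨ sum-unordered g diag ⟩
    sum (λ i → sum (g i))
      ≡⟨ ℚΣ.sum-cong-≗ (λ i → sym (ℚΣ.*-distribʳ-sum {n} (y i) _)) ⟩
    sum (λ i → residual x i ℚ.* y i) ∎)
    where
    -- The part of `residual x i ℚ.* y i` due to the ordered pair (i , j). An edge collects this
    -- part from both of its orientations.
    g : Fin n → Fin n → ℚ
    g i j = a i j ℚ.* (s i j ℚ.* x i ℚ.- x j) ℚ.* y i
    diag : ∀ i → g i i ≡ 0ℚ
    diag i rewrite dec-false (i ~? i) (~-irrefl refl) =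
      solve 2 (λ u v → con 0ℚ :* u :* v := con 0ℚ) refl (s i i ℚ.* x i ℚ.- x i) (y i)
    -- From s² = 1: s (xi - s xj)(yi - s yj) = (s xi - xj) yi + (s xj - xi) yj. The two signs are
    -- treated separately, each giving a polynomial identity.
    expand : ∀ i j →
      a i j ℚ.* (s i j ℚ.* (∇ x (i , j) ℚ.* ∇ y (i , j))) ≡ g i j ℚ.+ g j i
    expand i j rewrite a-sym j i | m-sym j i with m i j
    ... | true  = solve 5 (λ a xi xj yi yj →
      a :* (con (ℚ.- 1ℚ) :* ((xi :- con (ℚ.- 1ℚ) :* xj) :* (yi :- con (ℚ.- 1ℚ) :* yj))) :=
      a :* (con (ℚ.- 1ℚ) :* xi :- xj) :* yi :+ a :* (con (ℚ.- 1ℚ) :* xj :- xi) :* yj)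
      refl (a i j) (x i) (x j) (y i) (y j)
    ... | false = solve 5 (λ a xi xj yi yj →
      a :* (con 1ℚ :* ((xi :- con 1ℚ :* xj) :* (yi :- con 1ℚ :* yj))) :=
      a :* (con 1ℚ :* xi :- xj) :* yi :+ a :* (con 1ℚ :* xj :- xi) :* yj)
      refl (a i j) (x i) (x j) (y i) (y j)

  -- The rows of the matrix of `∇`, the form to which `fredholm` applies.
  incidence : Fin n × Fin n → Fin n → ℚ
  incidence (i , j) v = [ does (i Fin.≟ v) ] ℚ.- s i j ℚ.* [ does (j Fin.≟ v) ]

  incidence-∇ : ∀ x e → sum (λ v → incidence e v ℚ.* x v) ≡ ∇ x e
  incidence-∇ x (i , j) = begin
    sum (λ v → (δ i v ℚ.- s i j ℚ.* δ j v) ℚ.* x v)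
      ≡⟨ ℚΣ.sum-cong-≗ (λ v → solve 4 (λ d s e x →
           (d :- s :* e) :* x := d :* x :+ (:- s) :* (e :* x))
           refl (δ i v) (s i j) (δ j v) (x v)) ⟩
    sum (λ v → δ i v ℚ.* x v ℚ.+ ℚ.- s i j ℚ.* (δ j v ℚ.* x v))
      ≡⟨ sum-combine (ℚ.- s i j) (λ v → δ i v ℚ.* x v) _ ⟩
    sum (λ v → δ i v ℚ.* x v) ℚ.+ ℚ.- s i j ℚ.* sum (λ v → δ j v ℚ.* x v)
      ≡⟨ cong₂ (λ u w → u ℚ.+ ℚ.- s i j ℚ.* w) (sum-δ i x) (sum-δ j x) ⟩
    x i ℚ.+ ℚ.- s i j ℚ.* x j
      ≡⟨ cong (x i ℚ.+_) (sym (ℚ.neg-distribˡ-* (s i j) (x j))) ⟩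
    x i ℚ.- s i j ℚ.* x j ∎
    where
    δ : Fin n → Fin n → ℚ
    δ i v = [ does (i Fin.≟ v) ]

  seq-laplacian : ∀ i j k → seq (laplacian G i j) k ≡
    [ does (i Fin.≟ j) ] ℚ.* sum (a i) ℚ.- a i j
  seq-laplacian i j k = cong₂ ℚ._-_ diagonal (if-float (λ x → seq x k) (does (i ~? j)))
    where
    diagonal : seq (degreeMatrix G i j) k ≡ [ does (i Fin.≟ j) ] ℚ.* sum (a i)
    diagonal with does (i Fin.≟ j)
    ... | false = sym (ℚ.*-zeroˡ (sum (a i)))
    ... | true  = trans (seq-count (i ~?_) (allFin n) k)
      (trans (sumₗ-tabulate (a i) id) (sym (ℚ.*-identityˡ (sum (a i)))))

  -- The eigenvalue 2 is absorbed by the matching: the degree minus 2 equals the sum of the signs of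
  -- the edges at `i`, since exactly one of these edges has its sign changed from 1 to -1.
  laplacian-residual : ∀ X i k →
    seq ((laplacian G *ᵥ X) i - 2ℝ * X i) k ≡ residual (λ j → seq (X j) k) i
  laplacian-residual X i k = begin
    seq ((laplacian G *ᵥ X) i) k ℚ.- 2ℚ ℚ.* x i
      ≡⟨ cong (ℚ._- 2ℚ ℚ.* x i) (trans (seq-sum (λ j → laplacian G i j * X j) k)
           (ℚΣ.sum-cong-≗ λ j → cong (ℚ._* x j) (seq-laplacian i j k))) ⟩
    sum (λ j → (δ j ℚ.* deg ℚ.- a i j) ℚ.* x j) ℚ.- 2ℚ ℚ.* x i
      ≡⟨ cong (ℚ._- 2ℚ ℚ.* x i) (ℚΣ.sum-cong-≗ λ j → solve 4 (λ d g a x →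
           (d :* g :- a) :* x := d :* (g :* x) :+ con (ℚ.- 1ℚ) :* (a :* x))
           refl (δ j) deg (a i j) (x j)) ⟩
    sum (λ j → δ j ℚ.* (deg ℚ.* x j) ℚ.+ ℚ.- 1ℚ ℚ.* (a i j ℚ.* x j)) ℚ.- 2ℚ ℚ.* x i
      ≡⟨ cong (ℚ._- 2ℚ ℚ.* x i) (sum-combine (ℚ.- 1ℚ) (λ j → δ j ℚ.* (deg ℚ.* x j)) _) ⟩
    sum (λ j → δ j ℚ.* (deg ℚ.* x j)) ℚ.+ ℚ.- 1ℚ ℚ.* ax ℚ.- 2ℚ ℚ.* x i
      ≡⟨ cong (λ z → z ℚ.+ ℚ.- 1ℚ ℚ.* ax ℚ.- 2ℚ ℚ.* x i) (sum-δ i (λ j → deg ℚ.* x j)) ⟩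
    deg ℚ.* x i ℚ.+ ℚ.- 1ℚ ℚ.* ax ℚ.- 2ℚ ℚ.* x i
      ≡⟨ solve 3 (λ d a x → d :* x :+ con (ℚ.- 1ℚ) :* a :- con 2ℚ :* x :=
           (d :+ con (ℚ.- 2ℚ) :* con 1ℚ) :* x :+ con (ℚ.- 1ℚ) :* a) refl deg ax (x i) ⟩
    (deg ℚ.+ ℚ.- 2ℚ ℚ.* 1ℚ) ℚ.* x i ℚ.+ ℚ.- 1ℚ ℚ.* ax
      -- The factor 1 is replaced by the number of matched edges at `i`, so that the 2 can be
      -- distributed over the sum and `as≡a-2m` applied termwise.
      ≡⟨ cong (λ z → (deg ℚ.+ ℚ.- 2ℚ ℚ.* z) ℚ.* x i ℚ.+ ℚ.- 1ℚ ℚ.* ax)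
           (sum-δ (match i) (λ _ → 1ℚ)) ⟨
    (deg ℚ.+ ℚ.- 2ℚ ℚ.* sum (λ j → [ m i j ] ℚ.* 1ℚ)) ℚ.* x i ℚ.+ ℚ.- 1ℚ ℚ.* ax
      ≡⟨ cong (λ z → z ℚ.* x i ℚ.+ ℚ.- 1ℚ ℚ.* ax)
           (sum-combine (ℚ.- 2ℚ) (a i) (λ j → [ m i j ] ℚ.* 1ℚ)) ⟨
    sum (λ j → a i j ℚ.+ ℚ.- 2ℚ ℚ.* ([ m i j ] ℚ.* 1ℚ)) ℚ.* x i ℚ.+ ℚ.- 1ℚ ℚ.* ax
      ≡⟨ cong (λ z → z ℚ.* x i ℚ.+ ℚ.- 1ℚ ℚ.* ax) (ℚΣ.sum-cong-≗ λ j →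
           trans (as≡a-2m i j) (solve 2 (λ a m →
             a :- (m :+ m) := a :+ con (ℚ.- 2ℚ) :* (m :* con 1ℚ)) refl (a i j) [ m i j ])) ⟨
    sum (λ j → a i j ℚ.* s i j) ℚ.* x i ℚ.+ ℚ.- 1ℚ ℚ.* ax
      ≡⟨ cong (ℚ._+ ℚ.- 1ℚ ℚ.* ax) (ℚΣ.*-distribʳ-sum (x i) (λ j → a i j ℚ.* s i j)) ⟩
    sum (λ j → a i j ℚ.* s i j ℚ.* x i) ℚ.+ ℚ.- 1ℚ ℚ.* ax
      ≡⟨ sum-combine (ℚ.- 1ℚ) (λ j → a i j ℚ.* s i j ℚ.* x i) _ ⟨
    sum (λ j → a i j ℚ.* s i j ℚ.* x i ℚ.+ ℚ.- 1ℚ ℚ.* (a i j ℚ.* x j))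
      ≡⟨ ℚΣ.sum-cong-≗ (λ j → solve 4 (λ a s x y →
           a :* s :* x :+ con (ℚ.- 1ℚ) :* (a :* y) := a :* (s :* x :- y))
           refl (a i j) (s i j) (x i) (x j)) ⟩
    residual x i ∎
    where
    2ℚ = 1ℚ ℚ.+ 1ℚ
    x = λ j → seq (X j) k
    δ : Fin n → ℚ
    δ j = [ does (i Fin.≟ j) ]
    deg = sum (a i)
    ax = sum λ j → a i j ℚ.* x j

  -- The real kernel of the signed gradient and the eigenvectors for 2.

  E : Fin (length (edges G)) → Fin n × Fin n
  E = lookup (edges G)

  s² : ∀ i j → s i j ℚ.* s i j ≡ 1ℚ
  s² i j with m i j
  ... | true  = refl
  ... | false = refl

  -- At index `k` this is by definition `∇` of the `k`-th terms, so identities for `∇` lift to the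
  -- reals.
  ∇ℝ : Vector ℝ n → Fin n × Fin n → ℝ
  ∇ℝ X (i , j) = X i - fromℚ (s i j) * X j

  -- Taking `y` in `green` to be the unit vector at `i` writes entry `i` of (L - 2I) X as a
  -- combination of the entries of ∇ X with the rational coefficients `c`.
  ker∇⇒eigen : ∀ {X} → (∀ e → ∇ℝ X (E e) ≈ 0ℝ) →
    ∀ i → (laplacian G *ᵥ X) i ≈ 2ℝ * X i
  ker∇⇒eigen {X} ∇X≈0 i = RG.x∙y⁻¹≈ε⇒x≈y ((laplacian G *ᵥ X) i) (2ℝ * X i)
    (R.trans {(laplacian G *ᵥ X) i - 2ℝ * X i} {∑E} {0ℝ}
      (pointwise⇒≈ {(laplacian G *ᵥ X) i - 2ℝ * X i} {∑E} residual≡∑E)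
      (sum-≈0 term λ e → R.trans {term e} {0ℝ * c e} {0ℝ}
        (R.*-congʳ {c e} {∇ℝ X (E e)} {0ℝ} (∇X≈0 e)) (R.zeroˡ (c e))))
    where
    δ : Fin n → ℚ
    δ j = [ does (i Fin.≟ j) ]
    c term : Fin (length (edges G)) → ℝ
    c e = fromℚ ((λ (i , j) → s i j ℚ.* ∇ δ (i , j)) (E e))
    term e = ∇ℝ X (E e) * c e
    ∑E = ℝΣ.sum term
    residual≡∑E : ∀ k → seq ((laplacian G *ᵥ X) i - 2ℝ * X i) k ≡ seq ∑E k
    residual≡∑E k = begin
      seq ((laplacian G *ᵥ X) i - 2ℝ * X i) k
        ≡⟨ laplacian-residual X i k ⟩
      residual x i
        ≡⟨ sum-δ i (residual x) ⟨
      sum (λ j → δ j ℚ.* residual x j)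
        ≡⟨ ℚΣ.sum-cong-≗ (λ j → ℚ.*-comm (δ j) (residual x j)) ⟩
      sum (λ j → residual x j ℚ.* δ j)
        ≡⟨ green x δ ⟩
      sum ((λ (i , j) → s i j ℚ.* (∇ x (i , j) ℚ.* ∇ δ (i , j))) ∘ E)
        ≡⟨ ℚΣ.sum-cong-≗ (λ e → (λ (i , j) →
             solve 3 (λ s p q → s :* (p :* q) := p :* (s :* q)) refl
               (s i j) (∇ x (i , j)) (∇ δ (i , j))) (E e)) ⟩
      sum (λ e → seq (term e) k)
        ≡⟨ seq-sum term k ⟨
      seq ∑E k ∎
      where x = λ j → seq (X j) k

  -- Pairing (L − 2I) X = 0 with a solution y of ∇ y = s e · δ e isolates the entry of ∇ X at e.
  eigen⇒ker∇ : Surjective (incidence ∘ E) →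
    ∀ {X} → (∀ i → (laplacian G *ᵥ X) i ≈ 2ℝ * X i) → ∀ e → ∇ℝ X (E e) ≈ 0ℝ
  eigen⇒ker∇ surj {X} LX≈2X e = R.trans {∇ℝ X (E e)} {∑V} {0ℝ}
    (pointwise⇒≈ {∇ℝ X (E e)} {∑V} ∇≡∑V)
    (sum-≈0 term λ i → R.trans {term i} {0ℝ * fromℚ (y i)} {0ℝ}
      (R.*-congʳ {fromℚ (y i)} {(laplacian G *ᵥ X) i - 2ℝ * X i} {0ℝ}
        (RG.x≈y⇒x∙y⁻¹≈ε {(laplacian G *ᵥ X) i} {2ℝ * X i} (LX≈2X i)))
      (R.zeroˡ (fromℚ (y i))))
    where
    δ : Fin (length (edges G)) → ℚ
    δ e′ = [ does (e Fin.≟ e′) ]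
    sE : Fin (length (edges G)) → ℚ
    sE e′ = (λ (i , j) → s i j) (E e′)
    -- The factor `sE` in the right-hand side cancels the sign in `green`, because s² = 1.
    solution = surj λ e′ → δ e′ ℚ.* sE e′
    y = proj₁ solution
    ∇y : ∀ e′ → ∇ y (E e′) ≡ δ e′ ℚ.* sE e′
    ∇y e′ = trans (sym (incidence-∇ y (E e′))) (proj₂ solution e′)
    term : Fin n → ℝ
    term i = ((laplacian G *ᵥ X) i - 2ℝ * X i) * fromℚ (y i)
    ∑V = ℝΣ.sum term
    ∇≡∑V : ∀ k → seq (∇ℝ X (E e)) k ≡ seq ∑V k
    ∇≡∑V k = begin
      ∇ x (E e)
        ≡⟨ sum-δ e (∇ x ∘ E) ⟨
      sum (λ e′ → δ e′ ℚ.* ∇ x (E e′))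
        ≡⟨ ℚΣ.sum-cong-≗ (λ e′ → begin
             δ e′ ℚ.* ∇ x (E e′)
               ≡⟨ solve 2 (λ d p → d :* p := con 1ℚ :* (d :* p)) refl (δ e′) (∇ x (E e′)) ⟩
             1ℚ ℚ.* (δ e′ ℚ.* ∇ x (E e′))
               ≡⟨ cong (ℚ._* (δ e′ ℚ.* ∇ x (E e′))) (s² (proj₁ (E e′)) (proj₂ (E e′))) ⟨
             sE e′ ℚ.* sE e′ ℚ.* (δ e′ ℚ.* ∇ x (E e′))
               ≡⟨ solve 3 (λ s d p → s :* s :* (d :* p) := s :* (p :* (d :* s)))
                    refl (sE e′) (δ e′) (∇ x (E e′)) ⟩
             sE e′ ℚ.* (∇ x (E e′) ℚ.* (δ e′ ℚ.* sE e′))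
               ≡⟨ cong (λ z → sE e′ ℚ.* (∇ x (E e′) ℚ.* z)) (∇y e′) ⟨
             sE e′ ℚ.* (∇ x (E e′) ℚ.* ∇ y (E e′)) ∎) ⟩
      sum (λ e′ → sE e′ ℚ.* (∇ x (E e′) ℚ.* ∇ y (E e′)))
        ≡⟨ green x y ⟨
      sum (λ i → residual x i ℚ.* y i)
        ≡⟨ ℚΣ.sum-cong-≗ (λ i → cong (ℚ._* y i) (laplacian-residual X i k)) ⟨
      sum (λ i → seq (term i) k)
        ≡⟨ seq-sum term k ⟨
      seq ∑V k ∎
      where x = λ j → seq (X j) k

  -- A vanishing entry of ∇ X says that X i is s · X j with s = ±1. Only increasing pairs occur in
  -- `edges`; the reverse order follows from symmetry of `_≈±_`.
  ker∇-edge : ∀ {X} → (∀ e → ∇ℝ X (E e) ≈ 0ℝ) →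
    ∀ {i j} → i Fin.< j → i ~ j → X i ≈± X j
  ker∇-edge {X} ∇X≈0 {i} {j} i<j i~j =
    sign-≈± (m i j) {X i} {X j} (RG.x∙y⁻¹≈ε⇒x≈y (X i) (fromℚ (s i j) * X j)
      (subst (λ e → ∇ℝ X e ≈ 0ℝ) (sym (lookup-index ij∈edges)) (∇X≈0 (index ij∈edges))))
    where
    ij∈edges : (i , j) ∈ edges G
    ij∈edges = ∈-filter⁺ (λ (i , j) → (i Fin.<? j) ×-dec (i ~? j))
      (∈-cartesianProduct⁺ (∈-allFin i) (∈-allFin j)) (i<j , i~j)

  ker∇-adjacent : ∀ {X} → (∀ e → ∇ℝ X (E e) ≈ 0ℝ) → ∀ {i j} → i ~ j → X i ≈± X j
  ker∇-adjacent {X} ∇X≈0 {i} {j} i~j with Fin.<-cmp i j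
  ... | tri< i<j _ _ = ker∇-edge {X} ∇X≈0 i<j i~j
  ... | tri≈ _ i≡j _ = contradiction i~j (~-irrefl i≡j)
  ... | tri> _ _ j<i = ≈±-sym {X j} {X i} (ker∇-edge {X} ∇X≈0 j<i (~-sym i~j))

  ker∇-connected : ∀ {X} → (∀ e → ∇ℝ X (E e) ≈ 0ℝ) →
    ∀ {i j} → Star _~_ i j → X i ≈± X j
  ker∇-connected {X} ∇X≈0 {i} = fold (λ i j → X i ≈± X j)
    (λ {i} {j} {k} i~j → ≈±-trans {X i} {X j} {X k} (ker∇-adjacent {X} ∇X≈0 i~j))
    (λ {i} → inj₂ (R.refl {X i}))

  -- With as many edges as vertices, `fredholm` applies to the signed incidence matrix. A singular
  -- matrix supplies a rational kernel vector, embedded in ℝ; if the matrix is surjective, the given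
  -- eigenvector itself lies in the kernel.
  ker∇-nontrivial : length (edges G) ≡ n → IsEigenvalue (laplacian G) 2ℝ →
    Σ[ X ∈ Vector ℝ n ] (¬ (∀ i → X i ≈ 0ℝ) × (∀ e → ∇ℝ X (E e) ≈ 0ℝ))
  ker∇-nontrivial ∣E∣≡n (X , X≉0 , LX≈2X) =
    [ singular , surjective ]′ (fredholm ∣E∣≡n (incidence ∘ E))
    where
    Result = Σ[ X ∈ Vector ℝ n ] (¬ (∀ i → X i ≈ 0ℝ) × (∀ e → ∇ℝ X (E e) ≈ 0ℝ))
    singular : Singular (incidence ∘ E) → Result
    singular (z , (i , zᵢ≢0) , z∈ker) =
        fromℚ ∘ z
      , (λ z≈0 → zᵢ≢0 (fromℚ≈0⇒≡0 {z i} (z≈0 i)))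
      , λ e → pointwise⇒≈ {∇ℝ (fromℚ ∘ z) (E e)} {0ℝ} λ _ →
          trans (sym (incidence-∇ z (E e))) (z∈ker e)
    surjective : Surjective (incidence ∘ E) → Result
    surjective surj = X , X≉0 , eigen⇒ker∇ surj {X} LX≈2X

-- The eigenvector whose entries agree up to sign.

theorem5 : ∀ (n : ℕ) (G : Graph n) → Unicyclic G → PerfectMatching G →
    IsEigenvalue (laplacian G) 2ℝ →
    Σ[ r ∈ ℝ ] Σ[ X ∈ Vector ℝ n ]
    (r ≉ 0ℝ × IsEigenvector (laplacian G) 2ℝ X × (∀ i → X i ≈ - r ⊎ X i ≈ r))
-- Without vertices every vector is zero, so there is no eigenvector.
theorem5 zero    G _ _ (X , X≉0 , _) = contradiction (λ ()) X≉0
theorem5 (suc n) G ((_ , connected) , ∣E∣≡n) M eigenvalue =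
  let X , X≉0 , ∇X≈0 = ker∇-nontrivial ∣E∣≡n eigenvalue
      X≈±r : ∀ i → X i ≈± X zero
      X≈±r i = ker∇-connected {X} ∇X≈0 (connected i zero)
  -- The entry at vertex `zero` serves as r. It is nonzero, since otherwise connectedness would make
  -- every entry zero.
  in X zero , X
   , (λ r≈0 → X≉0 λ i → ≈±0⇒≈0 {X i} {X zero} (X≈±r i) r≈0)
   , (X≉0 , ker∇⇒eigen {X} ∇X≈0)
   , X≈±r
  where
  open PerfectMatching M
  match : Fin (suc n) → Fin (suc n)
  match i = proj₁ (covers i)
  matched : ∀ i → Matched i (match i)
  matched i = proj₁ (proj₂ (covers i))
  open SignedGraph G match
    -- By symmetry `match i` is matched with `i`, so uniqueness of its partner gives
    -- `match (match i) ≡ i`.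
    (λ i → proj₂ (proj₂ (covers (match i))) (matched-sym (matched i)))
    (λ i → matched⇒~ (matched i))
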